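{- Let $G$ be a graph with a length-function $\ell$ and let $T\subseteq G$ be a tree. If $T$ is $2$-geodesic in $G$, then $T$ is fully geodesic in $G$.
   Context: All graphs are finite; parallel edges are allowed, loops are not. A length-function on a graph $G$ is a map $\ell:E(G)\to\mathbb{R}^+$ (strictly positive reals); for a subgraph $H$ put $\ell(H)=\sum_{e\in E(H)}\ell(e)$, and subgraphs carry the restricted length-function. For $A\subseteq V(G)$, the Steiner distance $\mathrm{sd}_G(A)$ is the minimum of $\ell(S)$ over all connected subgraphs $S\subseteq G$ with $A\subseteq V(S)$ ($\infty$ if none exists). A subgraph $H\subseteq G$ is $k$-geodesic in $G$ if $\mathrm{sd}_H(A)=\mathrm{sd}_G(A)$ for every $A\subseteq V(H)$ with $|A|\le k$; it is fully geodesic in $G$ if it is $k$-geodesic for every $k\in\mathbb{N}$. -}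

module Defs where

open import Data.Fin using (Fin; _≟_)
open import Data.Fin.Properties using (all?)
open import Data.Fin.Subset using (Subset; inside; outside; _∈_; _⊆_; ∣_∣; ⊤; Nonempty; Lift)
open import Data.Fin.Subset.Properties using (_∈?_; _⊆?_; nonempty?; Lift?; ∈⊤)
open import Data.List using (List; []; _∷_; _++_; map; foldr; filter; mapMaybe; cartesianProduct; allFin)
open import Data.List.Membership.Propositional using () renaming (_∈_ to _∈ˡ_)
open import Data.List.Membership.Propositional.Properties using (∈-allFin; ∈-filter⁺; ∈-filter⁻)
open import Data.List.Relation.Unary.Any using (here; there)
open import Data.List.Relation.Unary.Unique.Propositional using (Unique)
open import Data.Maybe using (Maybe; just; nothing)
open import Data.Nat as ℕ using (ℕ; zero; suc)
import Data.Nat.Properties as ℕ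
open import Data.Product using (∃; _×_; _,_; proj₁; proj₂)
open import Data.Rational as ℚ using (ℚ; 0ℚ; ½)
import Data.Rational.Properties as ℚ
open import Data.Rational.Solver using (module +-*-Solver)
open import Data.Sum using (_⊎_; inj₁; inj₂)
open import Data.Vec using ([]; _∷_)
open import Level using (0ℓ)
open import Relation.Binary.PropositionalEquality using (_≡_; _≢_; refl; sym; trans; cong; subst)
open import Relation.Nullary using (Dec; yes; no; ¬_)
open import Relation.Nullary.Decidable using (map′; _×-dec_; _⊎-dec_; _→-dec_)
open import Relation.Unary using (Pred)

Cauchy : (ℕ → ℚ) → Set
Cauchy x = ∀ ε → 0ℚ ℚ.< ε →
  ∃ λ N → ∀ m n → N ℕ.≤ m → N ℕ.≤ n → ℚ.∣ x m ℚ.- x n ∣ ℚ.< ε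

-- Equality of reals is _≈_, not _≡_.
record ℝ : Set where
  constructor mkℝ
  field
    seq    : ℕ → ℚ
    cauchy : Cauchy seq

open ℝ public

infix 4 _≈_ _<_

_≈_ : ℝ → ℝ → Set
x ≈ y = ∀ ε → 0ℚ ℚ.< ε →
  ∃ λ N → ∀ n → N ℕ.≤ n → ℚ.∣ seq x n ℚ.- seq y n ∣ ℚ.< ε

_<_ : ℝ → ℝ → Set
x < y = ∃ λ ε → 0ℚ ℚ.< ε ×
  ∃ λ N → ∀ n → N ℕ.≤ n → seq x n ℚ.+ ε ℚ.≤ seq y n

0ℝ : ℝ
0ℝ = mkℝ (λ _ → 0ℚ) (λ ε 0<ε → 0 , λ _ _ _ _ → 0<ε)

private
  0<ε/2 : ∀ {ε} → 0ℚ ℚ.< ε → 0ℚ ℚ.< ½ ℚ.* ε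
  0<ε/2 0<ε = ℚ.*-monoʳ-<-pos ½ 0<ε

  halves : ∀ ε → ½ ℚ.* ε ℚ.+ ½ ℚ.* ε ≡ ε
  halves ε = trans (sym (ℚ.*-distribʳ-+ ε ½ ½)) (ℚ.*-identityˡ ε)

  interchange : ∀ p q r s → (p ℚ.+ q) ℚ.- (r ℚ.+ s) ≡ (p ℚ.- r) ℚ.+ (q ℚ.- s)
  interchange = solve 4 (λ p q r s → (p :+ q) :- (r :+ s) := (p :- r) :+ (q :- s)) refl
    where open +-*-Solver

  flip : ∀ p q → ℚ.- (p ℚ.- q) ≡ q ℚ.- p
  flip = solve 2 (λ p q → :- (p :- q) := q :- p) refl
    where open +-*-Solver

  +-close : ∀ {p q r s ε} → ℚ.∣ p ℚ.- r ∣ ℚ.< ½ ℚ.* ε → ℚ.∣ q ℚ.- s ∣ ℚ.< ½ ℚ.* ε →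
            ℚ.∣ (p ℚ.+ q) ℚ.- (r ℚ.+ s) ∣ ℚ.< ε
  +-close {p} {q} {r} {s} {ε} a b = begin-strict
    ℚ.∣ (p ℚ.+ q) ℚ.- (r ℚ.+ s) ∣          ≡⟨ cong ℚ.∣_∣ (interchange p q r s) ⟩
    ℚ.∣ (p ℚ.- r) ℚ.+ (q ℚ.- s) ∣          ≤⟨ ℚ.∣p+q∣≤∣p∣+∣q∣ (p ℚ.- r) (q ℚ.- s) ⟩
    ℚ.∣ p ℚ.- r ∣ ℚ.+ ℚ.∣ q ℚ.- s ∣        <⟨ ℚ.+-mono-< a b ⟩
    ½ ℚ.* ε ℚ.+ ½ ℚ.* ε                    ≡⟨ halves ε ⟩
    ε                                      ∎
    where open ℚ.≤-Reasoning

  p≤∣p∣ : ∀ p → p ℚ.≤ ℚ.∣ p ∣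
  p≤∣p∣ p with ℚ.≤-total 0ℚ p
  ... | inj₁ 0≤p = ℚ.≤-reflexive (sym (ℚ.0≤p⇒∣p∣≡p 0≤p))
  ... | inj₂ p≤0 = ℚ.≤-trans p≤0 (ℚ.0≤∣p∣ p)

  close⇒ : ∀ {p q ε} → ℚ.∣ p ℚ.- q ∣ ℚ.< ε → p ℚ.- q ℚ.< ε
  close⇒ = ℚ.≤-<-trans (p≤∣p∣ _)

  close-sym : ∀ {p q ε} → ℚ.∣ p ℚ.- q ∣ ℚ.< ε → ℚ.∣ q ℚ.- p ∣ ℚ.< ε
  close-sym {p} {q} {ε} =
    subst (ℚ._< ε) (trans (sym (ℚ.∣-p∣≡∣p∣ (p ℚ.- q))) (cong ℚ.∣_∣ (flip p q)))

  ⇒close : ∀ {p q ε} → p ℚ.- q ℚ.< ε → q ℚ.- p ℚ.< ε → ℚ.∣ p ℚ.- q ∣ ℚ.< ε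
  ⇒close {p} {q} {ε} a b with ℚ.∣p∣≡p∨∣p∣≡-p (p ℚ.- q)
  ... | inj₁ eq = subst (ℚ._< ε) (sym eq) a
  ... | inj₂ eq = subst (ℚ._< ε) (sym (trans eq (flip p q))) b

  ⊓-close₁ : ∀ {p q r s ε} → p ℚ.- r ℚ.< ε → q ℚ.- s ℚ.< ε → (p ℚ.⊓ q) ℚ.- (r ℚ.⊓ s) ℚ.< ε
  ⊓-close₁ {p} {q} {r} {s} a b with ℚ.⊓-sel r s
  ... | inj₁ eq rewrite eq = ℚ.≤-<-trans (ℚ.+-monoˡ-≤ (ℚ.- r) (ℚ.p⊓q≤p p q)) a
  ... | inj₂ eq rewrite eq = ℚ.≤-<-trans (ℚ.+-monoˡ-≤ (ℚ.- s) (ℚ.p⊓q≤q p q)) b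

  ⊓-close : ∀ {p q r s ε} → ℚ.∣ p ℚ.- r ∣ ℚ.< ε → ℚ.∣ q ℚ.- s ∣ ℚ.< ε →
            ℚ.∣ (p ℚ.⊓ q) ℚ.- (r ℚ.⊓ s) ∣ ℚ.< ε
  ⊓-close {p} {q} {r} {s} a b =
    ⇒close {p ℚ.⊓ q} {r ℚ.⊓ s}
      (⊓-close₁ {p} {q} {r} {s} (close⇒ {p} a) (close⇒ {q} b))
      (⊓-close₁ {r} {s} {p} {q} (close⇒ {r} (close-sym {p} a)) (close⇒ {s} (close-sym {q} b)))

infixl 6 _+_
infixl 7 _⊓_

_+_ : ℝ → ℝ → ℝ
x + y = mkℝ (λ n → seq x n ℚ.+ seq y n) λ ε 0<ε →
  let M , x-close = cauchy x (½ ℚ.* ε) (0<ε/2 0<ε)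
      N , y-close = cauchy y (½ ℚ.* ε) (0<ε/2 0<ε)
  in  M ℕ.⊔ N , λ m n M⊔N≤m M⊔N≤n →
        +-close {seq x m} {seq y m} {seq x n} {seq y n}
          (x-close m n (ℕ.m⊔n≤o⇒m≤o M N M⊔N≤m) (ℕ.m⊔n≤o⇒m≤o M N M⊔N≤n))
          (y-close m n (ℕ.m⊔n≤o⇒n≤o M N M⊔N≤m) (ℕ.m⊔n≤o⇒n≤o M N M⊔N≤n))

_⊓_ : ℝ → ℝ → ℝ
x ⊓ y = mkℝ (λ n → seq x n ℚ.⊓ seq y n) λ ε 0<ε →
  let M , x-close = cauchy x ε 0<ε
      N , y-close = cauchy y ε 0<ε
  in  M ℕ.⊔ N , λ m n M⊔N≤m M⊔N≤n →
        ⊓-close {seq x m} {seq y m} {seq x n} {seq y n}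
          (x-close m n (ℕ.m⊔n≤o⇒m≤o M N M⊔N≤m) (ℕ.m⊔n≤o⇒m≤o M N M⊔N≤n))
          (y-close m n (ℕ.m⊔n≤o⇒n≤o M N M⊔N≤m) (ℕ.m⊔n≤o⇒n≤o M N M⊔N≤n))

data ℝ∞ : Set where
  fin : ℝ → ℝ∞
  ∞   : ℝ∞

infix 4 _≈∞_

data _≈∞_ : ℝ∞ → ℝ∞ → Set where
  fin : ∀ {x y} → x ≈ y → fin x ≈∞ fin y
  ∞   : ∞ ≈∞ ∞

_⊓∞_ : ℝ∞ → ℝ∞ → ℝ∞
fin x ⊓∞ fin y = fin (x ⊓ y)
fin x ⊓∞ ∞     = fin x
∞     ⊓∞ y     = y

minimum : List ℝ → ℝ∞
minimum = foldr (λ x y → fin x ⊓∞ y) ∞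

-- The order of the two ends of an edge carries no meaning: see Joins.
record Graph : Set where
  field
    #V #E    : ℕ
    ends     : Fin #E → Fin #V × Fin #V
    loopless : ∀ e → proj₁ (ends e) ≢ proj₂ (ends e)

  V E : Set
  V = Fin #V
  E = Fin #E

  Joins : E → V → V → Set
  Joins e u v = ends e ≡ (u , v) ⊎ ends e ≡ (v , u)

  data Walk (P : Pred E 0ℓ) : V → V → Set where
    nil  : ∀ {v} → Walk P v v
    cons : ∀ {u v w} e → P e → Joins e u v → Walk P v w → Walk P u w

  walkEdges : ∀ {P u v} → Walk P u v → List E
  walkEdges nil            = []
  walkEdges (cons e _ _ p) = e ∷ walkEdges p

  -- omits the final vertex, which on a closed walk repeats the first one
  walkVertices : ∀ {P u v} → Walk P u v → List V
  walkVertices nil                = []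
  walkVertices (cons {u} _ _ _ p) = u ∷ walkVertices p

  -- Distinctness of the edges excludes traversing one edge back and forth,
  -- while two parallel edges do form a cycle.
  IsCycle : ∀ {P v} → Walk P v v → Set
  IsCycle c = walkEdges c ≢ [] × Unique (walkEdges c) × Unique (walkVertices c)

open Graph public using (#V; #E; ends; loopless; V; E; Joins; Walk; nil; cons; walkEdges; walkVertices; IsCycle)

record Subgraph (G : Graph) : Set where
  constructor mkSubgraph
  field
    vertices : Subset (#V G)
    edges    : Subset (#E G)
    closed   : Lift (λ e → proj₁ (ends G e) ∈ vertices × proj₂ (ends G e) ∈ vertices) edges

open Subgraph public

whole : ∀ G → Subgraph G
whole G = mkSubgraph ⊤ ⊤ (λ _ → ∈⊤ , ∈⊤)

module _ {G : Graph} where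

  infix 4 _⊑_

  _⊑_ : Subgraph G → Subgraph G → Set
  S ⊑ H = vertices S ⊆ vertices H × edges S ⊆ edges H

  WalkIn : Subgraph G → V G → V G → Set
  WalkIn H = Walk G (_∈ edges H)

  -- The graph without vertices is not connected.
  Connected : Subgraph G → Set
  Connected H = Nonempty (vertices H) ×
    (∀ u v → u ∈ vertices H → v ∈ vertices H → WalkIn H u v)

  Acyclic : Subgraph G → Set
  Acyclic H = ∀ {v} (c : WalkIn H v v) → ¬ IsCycle G c

  IsTree : Subgraph G → Set
  IsTree T = Connected T × Acyclic T

module _ (G : Graph) where

  private
    Via : List (E G) → V G → V G → Set
    Via es = Walk G (_∈ˡ es)

    weaken : ∀ {P Q : Pred (E G) 0ℓ} {u v} → (∀ {e} → P e → Q e) → Walk G P u v → Walk G Q u v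
    weaken f nil            = nil
    weaken f (cons e p j w) = cons e (f p) j (weaken f w)

    append : ∀ {P u v w} → Walk G P u v → Walk G P v w → Walk G P u w
    append nil            q = q
    append (cons e p j w) q = cons e p j (append w q)

    -- a walk through e ∷ es can be chosen to use e at most once
    Split : E G → List (E G) → V G → V G → Set
    Split e es u v = Via es u v
      ⊎ (Via es u (proj₁ (ends G e)) × Via es (proj₂ (ends G e)) v)
      ⊎ (Via es u (proj₂ (ends G e)) × Via es (proj₁ (ends G e)) v)

    join : ∀ {e es u v} → Split e es u v → Via (e ∷ es) u v
    join (inj₁ w)                  = weaken there w
    join {e} (inj₂ (inj₁ (p , q))) =
      append (weaken there p) (cons e (here refl) (inj₁ refl) (weaken there q))
    join {e} (inj₂ (inj₂ (p , q))) =
      append (weaken there p) (cons e (here refl) (inj₂ refl) (weaken there q))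

    split : ∀ {e es u v} → Via (e ∷ es) u v → Split e es u v
    split nil = inj₁ nil
    split (cons e (there i) j w) with split w
    ... | inj₁ q              = inj₁ (cons e i j q)
    ... | inj₂ (inj₁ (p , q)) = inj₂ (inj₁ (cons e i j p , q))
    ... | inj₂ (inj₂ (p , q)) = inj₂ (inj₂ (cons e i j p , q))
    split (cons e (here refl) (inj₁ refl) w) with split w
    ... | inj₁ q              = inj₂ (inj₁ (nil , q))
    ... | inj₂ (inj₁ (_ , q)) = inj₂ (inj₁ (nil , q))
    ... | inj₂ (inj₂ (_ , q)) = inj₁ q
    split (cons e (here refl) (inj₂ refl) w) with split w
    ... | inj₁ q              = inj₂ (inj₂ (nil , q))
    ... | inj₂ (inj₁ (_ , q)) = inj₁ q
    ... | inj₂ (inj₂ (_ , q)) = inj₂ (inj₂ (nil , q))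

    via? : ∀ es u v → Dec (Via es u v)
    via? []       u v = map′ (λ { refl → nil }) (λ { nil → refl ; (cons _ () _ _) }) (u ≟ v)
    via? (e ∷ es) u v = map′ join split
      (via? es u v
        ⊎-dec (via? es u (proj₁ (ends G e)) ×-dec via? es (proj₂ (ends G e)) v)
        ⊎-dec (via? es u (proj₂ (ends G e)) ×-dec via? es (proj₁ (ends G e)) v))

  edgeList : Subset (#E G) → List (E G)
  edgeList F = filter (_∈? F) (allFin (#E G))

  walk? : ∀ F u v → Dec (Walk G (_∈ F) u v)
  walk? F u v = map′
    (weaken (λ i → proj₂ (∈-filter⁻ (_∈? F) {xs = allFin (#E G)} i)))
    (weaken (λ {e} e∈F → ∈-filter⁺ (_∈? F) (∈-allFin e) e∈F))
    (via? (edgeList F) u v)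

  connected? : ∀ (H : Subgraph G) → Dec (Connected H)
  connected? H = nonempty? (vertices H) ×-dec
    all? λ u → all? λ v →
      (u ∈? vertices H) →-dec ((v ∈? vertices H) →-dec walk? (edges H) u v)

record LengthFunction (G : Graph) : Set where
  field
    len      : E G → ℝ
    positive : ∀ e → 0ℝ < len e

open LengthFunction public

subsets : ∀ n → List (Subset n)
subsets zero    = [] ∷ []
subsets (suc n) = map (inside ∷_) (subsets n) ++ map (outside ∷_) (subsets n)

toSubgraph : ∀ G → Subset (#V G) × Subset (#E G) → Maybe (Subgraph G)
toSubgraph G (U , F)
  with Lift? (λ e → (proj₁ (ends G e) ∈? U) ×-dec (proj₂ (ends G e) ∈? U)) F
... | yes c = just (mkSubgraph U F c)
... | no  _ = nothing

subgraphs : ∀ G → List (Subgraph G)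
subgraphs G = mapMaybe (toSubgraph G) (cartesianProduct (subsets (#V G)) (subsets (#E G)))

module _ {G : Graph} (ℓ : LengthFunction G) where

  totalLength : Subgraph G → ℝ
  totalLength S = foldr (λ e r → len ℓ e + r) 0ℝ (edgeList G (edges S))

  Connects : Subgraph G → Subset (#V G) → Subgraph G → Set
  Connects H A S = S ⊑ H × A ⊆ vertices S × Connected S

  connects? : ∀ H A S → Dec (Connects H A S)
  connects? H A S =
    ((vertices S ⊆? vertices H) ×-dec (edges S ⊆? edges H))
      ×-dec ((A ⊆? vertices S) ×-dec connected? G S)

  -- ∞ if no connected subgraph of H contains A (minimum [] = ∞)
  sd : Subgraph G → Subset (#V G) → ℝ∞
  sd H A = minimum (map totalLength (filter (connects? H A) (subgraphs G)))

  Geodesic : ℕ → Subgraph G → Set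
  Geodesic k H = ∀ A → A ⊆ vertices H → ∣ A ∣ ℕ.≤ k → sd H A ≈∞ sd (whole G) A

  FullyGeodesic : Subgraph G → Set
  FullyGeodesic H = ∀ k → Geodesic k H

{-# OPTIONS --safe #-}

-- Let S be a connected subgraph of G containing A ⊆ V(T) and fix a ∈ A.  Some closed walk at a
-- in S visits all of A and uses every edge at most twice.  Cut it at its vertices in T.  As T is
-- 2-geodesic, a piece from u to v is at least as long as the set of edges of T separating u from
-- v in T.  An edge of T separating a from some b ∈ A therefore is counted at least twice, once
-- before and once after b, so these edges have total length at most ℓ(S).  They contain the
-- a–b path of T for every b ∈ A, hence connect A inside T.
--
-- All lengths are of the form weight c = Σ c(e) ℓ(e) with c : E → ℕ, and they are compared via
-- edgewise inequalities between multiplicities.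
module Submission where

open import Defs

import Algebra.Properties.CommutativeSemigroup as CommutativeSemigroupProperties
open import Data.Empty using (⊥-elim)
open import Data.Fin using (Fin; _≟_)
open import Data.Fin.Properties using (any?)
open import Data.Fin.Subset using (Subset; inside; outside; _∈_; _⊆_; ∣_∣; ⊥; ⁅_⁆; _∪_; Nonempty)
open import Data.Fin.Subset.Properties using (_∈?_; nonempty?; ∈⊤; ∉⊥; x∈⁅x⁆; x∈⁅y⁆⇒x≡y; ∣⁅x⁆∣≡1; x∈p∪q⁺; x∈p∪q⁻; Lift?)
open import Data.List using (List; []; _∷_; map; foldr; filter; allFin)
open import Data.List.Properties using (filter-accept; filter-reject)
open import Data.List.Membership.Propositional using (lose) renaming (_∈_ to _∈ˡ_; _∉_ to _∉ˡ_)
import Data.List.Membership.DecPropositional as DecMembership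
open import Data.List.Membership.Propositional.Properties using (∈-map⁺; ∈-map⁻; ∈-++⁺ˡ; ∈-++⁺ʳ; ∈-filter⁺; ∈-filter⁻; ∈-cartesianProduct⁺; ∈-allFin)
open import Data.List.Relation.Unary.All using ([]; _∷_)
import Data.List.Relation.Unary.All as All
open import Data.List.Relation.Unary.AllPairs using ([]; _∷_)
open import Data.List.Relation.Unary.Any using (here; there)
import Data.List.Relation.Unary.Any.Properties as Any
open import Data.List.Relation.Unary.Unique.Propositional using (Unique)
open import Data.Maybe using (just)
import Data.Maybe.Relation.Unary.Any as Maybe
open import Data.Nat as ℕ using (ℕ; zero; suc; z≤n; s≤s)
import Data.Nat.Properties as ℕ
open import Data.Product using (∃; ∃₂; _×_; _,_; proj₁; proj₂)
open import Data.Rational as ℚ using (ℚ; 0ℚ; ½)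
import Data.Rational.Properties as ℚ
open import Data.Rational.Solver using (module +-*-Solver)
open import Data.Sum using (_⊎_; inj₁; inj₂)
open import Data.Vec using (tabulate; []; _∷_)
open import Data.Vec.Properties using (lookup∘tabulate; []=⇒lookup; lookup⇒[]=)
open import Function using (_∘_; id)
open import Level using (0ℓ)
open import Relation.Binary.PropositionalEquality using (_≡_; _≢_; refl; sym; trans; cong; cong₂; subst; subst₂; module ≡-Reasoning)
open import Relation.Nullary using (Dec; yes; no; ¬_; does; contradiction)
open import Relation.Nullary.Decidable using (¬?; _×-dec_; dec-true)
open import Relation.Unary using (Pred; Decidable)

-- Order on ℝ

Eventually : Pred ℕ 0ℓ → Set
Eventually P = ∃ λ N → ∀ n → N ℕ.≤ n → P n

eventually-map : ∀ {P Q : Pred ℕ 0ℓ} → (∀ n → P n → Q n) → Eventually P → Eventually Q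
eventually-map f (N , p) = N , λ n N≤n → f n (p n N≤n)

eventually-map₂ : ∀ {P Q R : Pred ℕ 0ℓ} → (∀ n → P n → Q n → R n) →
                  Eventually P → Eventually Q → Eventually R
eventually-map₂ f (M , p) (N , q) = M ℕ.⊔ N , λ n M⊔N≤n →
  f n (p n (ℕ.m⊔n≤o⇒m≤o M N M⊔N≤n)) (q n (ℕ.m⊔n≤o⇒n≤o M N M⊔N≤n))

infix 4 _≤_ _≐_

-- The order of the limits, with the slack ε making it independent of the representing sequences: by
-- `≈⇒≤` and `≤-antisym` its symmetric part is `_≈_`.
record _≤_ (x y : ℝ) : Set where
  constructor mk≤
  field
    bound : ∀ ε → 0ℚ ℚ.< ε → Eventually λ n → seq x n ℚ.≤ seq y n ℚ.+ ε

open _≤_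

-- The algebraic identities between weights hold term by term. Propositional equality in ℝ would
-- also have to identify the Cauchy proofs.
record _≐_ (x y : ℝ) : Set where
  constructor mk≐
  field
    pointwise : ∀ n → seq x n ≡ seq y n

open _≐_

≐-sym : ∀ {x y} → x ≐ y → y ≐ x
≐-sym x≐y = mk≐ λ n → sym (pointwise x≐y n)

halves : ∀ ε → ½ ℚ.* ε ℚ.+ ½ ℚ.* ε ≡ ε
halves ε = trans (sym (ℚ.*-distribʳ-+ ε ½ ½)) (ℚ.*-identityˡ ε)

half-positive : ∀ {ε} → 0ℚ ℚ.< ε → 0ℚ ℚ.< ½ ℚ.* ε
half-positive 0<ε = ℚ.*-monoʳ-<-pos ½ 0<ε

p≤p+ε : ∀ p {ε} → 0ℚ ℚ.< ε → p ℚ.≤ p ℚ.+ ε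
p≤p+ε p {ε} 0<ε = subst (ℚ._≤ p ℚ.+ ε) (ℚ.+-identityʳ p) (ℚ.+-monoʳ-≤ p (ℚ.<⇒≤ 0<ε))

p≤∣p∣ : ∀ p → p ℚ.≤ ℚ.∣ p ∣
p≤∣p∣ p with ℚ.≤-total 0ℚ p
... | inj₁ 0≤p = ℚ.≤-reflexive (sym (ℚ.0≤p⇒∣p∣≡p 0≤p))
... | inj₂ p≤0 = ℚ.≤-trans p≤0 (ℚ.0≤∣p∣ p)

≐⇒≤ : ∀ {x y} → x ≐ y → x ≤ y
≐⇒≤ {x} {y} x≐y = mk≤ λ ε 0<ε → 0 , λ n _ →
  subst (ℚ._≤ seq y n ℚ.+ ε) (sym (pointwise x≐y n)) (p≤p+ε (seq y n) 0<ε)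

≤-refl : ∀ {x} → x ≤ x
≤-refl = ≐⇒≤ (mk≐ λ _ → refl)

≤-trans : ∀ {x y z} → x ≤ y → y ≤ z → x ≤ z
≤-trans {x} {y} {z} x≤y y≤z = mk≤ λ ε 0<ε →
  eventually-map₂ (λ n p q → subst (λ ε → seq x n ℚ.≤ seq z n ℚ.+ ε) (halves ε)
      (chain (seq x n) (seq y n) (seq z n) (½ ℚ.* ε) p q))
    (bound x≤y _ (half-positive 0<ε)) (bound y≤z _ (half-positive 0<ε))
  where
  open ℚ.≤-Reasoning
  chain : ∀ p q r δ → p ℚ.≤ q ℚ.+ δ → q ℚ.≤ r ℚ.+ δ → p ℚ.≤ r ℚ.+ (δ ℚ.+ δ)
  chain p q r δ p≤q q≤r = begin
    p                    ≤⟨ p≤q ⟩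
    q ℚ.+ δ              ≤⟨ ℚ.+-monoˡ-≤ δ q≤r ⟩
    r ℚ.+ δ ℚ.+ δ        ≡⟨ ℚ.+-assoc r δ δ ⟩
    r ℚ.+ (δ ℚ.+ δ)      ∎

+-mono-≤ : ∀ {x y z w} → x ≤ y → z ≤ w → x + z ≤ y + w
+-mono-≤ {x} {y} {z} {w} x≤y z≤w = mk≤ λ ε 0<ε →
  eventually-map₂ (λ n p q → subst (λ ε → seq x n ℚ.+ seq z n ℚ.≤ seq y n ℚ.+ seq w n ℚ.+ ε) (halves ε)
      (add (seq x n) (seq y n) (seq z n) (seq w n) (½ ℚ.* ε) p q))
    (bound x≤y _ (half-positive 0<ε)) (bound z≤w _ (half-positive 0<ε))
  where
  open ℚ.≤-Reasoning
  open +-*-Solver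
  add : ∀ p q r s δ → p ℚ.≤ q ℚ.+ δ → r ℚ.≤ s ℚ.+ δ → p ℚ.+ r ℚ.≤ q ℚ.+ s ℚ.+ (δ ℚ.+ δ)
  add p q r s δ p≤q r≤s = begin
    p ℚ.+ r                    ≤⟨ ℚ.+-mono-≤ p≤q r≤s ⟩
    q ℚ.+ δ ℚ.+ (s ℚ.+ δ)      ≡⟨ solve 3 (λ q s δ → q :+ δ :+ (s :+ δ) := q :+ s :+ (δ :+ δ)) refl q s δ ⟩
    q ℚ.+ s ℚ.+ (δ ℚ.+ δ)      ∎

-- The same ε serves before and after halving: `q + ε < p` would give `2q + ε < 2q + 2ε < 2p`.
double-cancel-≤ : ∀ {x y} → x + x ≤ y + y → x ≤ y
double-cancel-≤ {x} {y} 2x≤2y = mk≤ λ ε 0<ε →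
  eventually-map (λ n → cancel (seq x n) (seq y n) ε 0<ε) (bound 2x≤2y ε 0<ε)
  where
  cancel : ∀ p q ε → 0ℚ ℚ.< ε → p ℚ.+ p ℚ.≤ q ℚ.+ q ℚ.+ ε → p ℚ.≤ q ℚ.+ ε
  cancel p q ε 0<ε 2p≤2q+ε = ℚ.≮⇒≥ λ q+ε<p → ℚ.<-irrefl refl (begin-strict
    q ℚ.+ q ℚ.+ ε      ≡⟨ ℚ.+-assoc q q ε ⟩
    q ℚ.+ (q ℚ.+ ε)    ≤⟨ ℚ.+-monoˡ-≤ (q ℚ.+ ε) (p≤p+ε q 0<ε) ⟩
    q ℚ.+ ε ℚ.+ (q ℚ.+ ε)  <⟨ ℚ.+-mono-< q+ε<p q+ε<p ⟩
    p ℚ.+ p            ≤⟨ 2p≤2q+ε ⟩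
    q ℚ.+ q ℚ.+ ε      ∎)
    where open ℚ.≤-Reasoning

positive⇒nonnegative : ∀ {x} → 0ℝ < x → 0ℝ ≤ x
positive⇒nonnegative {x} (δ , 0<δ , N , 0+δ≤x) = mk≤ λ ε 0<ε → N , λ n N≤n →
  ℚ.≤-trans (p≤p+ε 0ℚ 0<δ) (ℚ.≤-trans (0+δ≤x n N≤n) (p≤p+ε (seq x n) 0<ε))

⊓-≤ˡ : ∀ x y → x ⊓ y ≤ x
⊓-≤ˡ x y = mk≤ λ ε 0<ε → 0 , λ n _ → ℚ.≤-trans (ℚ.p⊓q≤p (seq x n) (seq y n)) (p≤p+ε (seq x n) 0<ε)

⊓-≤ʳ : ∀ x y → x ⊓ y ≤ y
⊓-≤ʳ x y = mk≤ λ ε 0<ε → 0 , λ n _ → ℚ.≤-trans (ℚ.p⊓q≤q (seq x n) (seq y n)) (p≤p+ε (seq y n) 0<ε)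

⊓-glb : ∀ {x y z} → z ≤ x → z ≤ y → z ≤ x ⊓ y
⊓-glb {x} {y} {z} z≤x z≤y = mk≤ λ ε 0<ε →
  eventually-map₂ (λ n → combine (seq x n) (seq y n) (seq z n) ε) (bound z≤x ε 0<ε) (bound z≤y ε 0<ε)
  where
  combine : ∀ p q r ε → r ℚ.≤ p ℚ.+ ε → r ℚ.≤ q ℚ.+ ε → r ℚ.≤ p ℚ.⊓ q ℚ.+ ε
  combine p q r ε r≤p r≤q with ℚ.⊓-sel p q
  ... | inj₁ eq rewrite eq = r≤p
  ... | inj₂ eq rewrite eq = r≤q

close⇒≤ : ∀ p q ε → ℚ.∣ p ℚ.- q ∣ ℚ.< ε → p ℚ.≤ q ℚ.+ ε
close⇒≤ p q ε ∣p-q∣<ε = begin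
  p                  ≡⟨ solve 2 (λ p q → p := q :+ (p :- q)) refl p q ⟩
  q ℚ.+ (p ℚ.- q)    ≤⟨ ℚ.+-monoʳ-≤ q (ℚ.≤-trans (p≤∣p∣ (p ℚ.- q)) (ℚ.<⇒≤ ∣p-q∣<ε)) ⟩
  q ℚ.+ ε            ∎
  where open ℚ.≤-Reasoning
        open +-*-Solver

≤⇒-≤ : ∀ p q ε → p ℚ.≤ q ℚ.+ ε → p ℚ.- q ℚ.≤ ε
≤⇒-≤ p q ε p≤q+ε = begin
  p ℚ.- q            ≤⟨ ℚ.+-monoˡ-≤ (ℚ.- q) p≤q+ε ⟩
  q ℚ.+ ε ℚ.- q      ≡⟨ solve 2 (λ q ε → q :+ ε :- q := ε) refl q ε ⟩
  ε                  ∎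
  where open ℚ.≤-Reasoning
        open +-*-Solver

-‿flip : ∀ p q → ℚ.- (p ℚ.- q) ≡ q ℚ.- p
-‿flip = solve 2 (λ p q → :- (p :- q) := q :- p) refl
  where open +-*-Solver

≈⇒≤ : ∀ {x y} → x ≈ y → x ≤ y
≈⇒≤ {x} {y} x≈y = mk≤ λ ε 0<ε → eventually-map (λ n → close⇒≤ (seq x n) (seq y n) ε) (x≈y ε 0<ε)

≤-antisym : ∀ {x y} → x ≤ y → y ≤ x → x ≈ y
≤-antisym {x} {y} x≤y y≤x ε 0<ε =
  -- The two bounds give a distance of at most their slack, while `_≈_` asks for strictly less than
  -- ε; taking half of ε provides the strictness.
  eventually-map₂ (λ n p q → ℚ.≤-<-trans (close (seq x n) (seq y n) (½ ℚ.* ε) p q) ½ε<ε)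
    (bound x≤y _ (half-positive 0<ε)) (bound y≤x _ (half-positive 0<ε))
  where
  ½ε<ε : ½ ℚ.* ε ℚ.< ε
  ½ε<ε = subst₂ ℚ._<_ (ℚ.+-identityʳ _) (halves ε) (ℚ.+-monoʳ-< (½ ℚ.* ε) (half-positive 0<ε))
  close : ∀ p q δ → p ℚ.≤ q ℚ.+ δ → q ℚ.≤ p ℚ.+ δ → ℚ.∣ p ℚ.- q ∣ ℚ.≤ δ
  close p q δ p≤q q≤p with ℚ.∣p∣≡p∨∣p∣≡-p (p ℚ.- q)
  ... | inj₁ eq = subst (ℚ._≤ δ) (sym eq) (≤⇒-≤ p q δ p≤q)
  ... | inj₂ eq = subst (ℚ._≤ δ) (sym (trans eq (-‿flip p q))) (≤⇒-≤ q p δ q≤p)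

-- Natural multiples of reals

infixr 8 _·_

_·_ : ℕ → ℝ → ℝ
zero  · x = 0ℝ
suc n · x = x + n · x

·-distribʳ-+ : ∀ x m n k → seq ((m ℕ.+ n) · x) k ≡ seq (m · x) k ℚ.+ seq (n · x) k
·-distribʳ-+ x zero    n k = sym (ℚ.+-identityˡ (seq (n · x) k))
·-distribʳ-+ x (suc m) n k =
  trans (cong (seq x k ℚ.+_) (·-distribʳ-+ x m n k))
        (sym (ℚ.+-assoc (seq x k) (seq (m · x) k) (seq (n · x) k)))

0≤x+y : ∀ x y → 0ℝ ≤ x → 0ℝ ≤ y → 0ℝ ≤ x + y
0≤x+y x y 0≤x 0≤y = ≤-trans {0ℝ} {0ℝ + 0ℝ} {x + y}
  (≐⇒≤ {0ℝ} {0ℝ + 0ℝ} (mk≐ λ _ → refl)) (+-mono-≤ {0ℝ} {x} {0ℝ} {y} 0≤x 0≤y)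

·-nonneg : ∀ x n → 0ℝ ≤ x → 0ℝ ≤ n · x
·-nonneg x zero    0≤x = ≤-refl {0ℝ}
·-nonneg x (suc n) 0≤x = 0≤x+y x (n · x) 0≤x (·-nonneg x n 0≤x)

·-monoˡ-≤ : ∀ x {m n} → 0ℝ ≤ x → m ℕ.≤ n → m · x ≤ n · x
·-monoˡ-≤ x 0≤x (z≤n {n})         = ·-nonneg x n 0≤x
·-monoˡ-≤ x 0≤x (s≤s {m} {n} m≤n) =
  +-mono-≤ {x} {x} {m · x} {n · x} (≤-refl {x}) (·-monoˡ-≤ x 0≤x m≤n)

-- Order on ℝ∞ and minima

infix 4 _≤∞_

data _≤∞_ : ℝ∞ → ℝ∞ → Set where
  fin : ∀ {x y} → x ≤ y → fin x ≤∞ fin y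
  top : ∀ {x} → x ≤∞ ∞

≤∞-trans : ∀ {x y z} → x ≤∞ y → y ≤∞ z → x ≤∞ z
≤∞-trans _ top = top
≤∞-trans (fin {x} {y} p) (fin {_} {z} q) = fin (≤-trans p q)

≤∞-antisym : ∀ {x y} → x ≤∞ y → y ≤∞ x → x ≈∞ y
≤∞-antisym (fin {x} {y} p) (fin q) = fin (≤-antisym p q)
≤∞-antisym top             top     = ∞

≈∞⇒≤∞ : ∀ {x y} → x ≈∞ y → x ≤∞ y
≈∞⇒≤∞ (fin {x} {y} p) = fin (≈⇒≤ p)
≈∞⇒≤∞ ∞               = top

fin⁻¹ : ∀ {x y} → fin x ≤∞ fin y → x ≤ y
fin⁻¹ (fin p) = p

minimum-≤ : ∀ {x xs} → x ∈ˡ xs → minimum xs ≤∞ fin x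
minimum-≤ {x} {_ ∷ ys} (here refl) with minimum ys
... | fin m = fin (⊓-≤ˡ x m)
... | ∞     = fin (≤-refl)
minimum-≤ {x} {y ∷ ys} (there x∈ys) with minimum ys | minimum-≤ x∈ys
... | fin m | fin m≤x = fin (≤-trans (⊓-≤ʳ y m) m≤x)

minimum-glb : ∀ {y} xs → (∀ {x} → x ∈ˡ xs → y ≤∞ fin x) → y ≤∞ minimum xs
minimum-glb []       lower = top
minimum-glb (x ∷ xs) lower with minimum xs | minimum-glb xs (lower ∘ there) | lower (here refl)
... | fin m | fin {y} y≤m | fin y≤x = fin (⊓-glb y≤x y≤m)
... | ∞     | _           | y≤x     = y≤x

-- Finite subsets

comprehension : ∀ {n} {P : Pred (Fin n) 0ℓ} → Decidable P → Subset n
comprehension P? = tabulate (does ∘ P?)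

module _ {n} {P : Pred (Fin n) 0ℓ} (P? : Decidable P) where

  ∈-comprehension⁺ : ∀ {x} → P x → x ∈ comprehension P?
  ∈-comprehension⁺ {x} px =
    lookup⇒[]= x _ (trans (lookup∘tabulate (does ∘ P?) x) (dec-true (P? x) px))

  ∈-comprehension⁻ : ∀ {x} → x ∈ comprehension P? → P x
  ∈-comprehension⁻ {x} x∈ with P? x | trans (sym (lookup∘tabulate (does ∘ P?) x)) ([]=⇒lookup x∈)
  ... | yes px | _ = px

∣p∪q∣≤∣p∣+∣q∣ : ∀ {n} (p q : Subset n) → ∣ p ∪ q ∣ ℕ.≤ ∣ p ∣ ℕ.+ ∣ q ∣
∣p∪q∣≤∣p∣+∣q∣ []            []            = z≤n
∣p∪q∣≤∣p∣+∣q∣ (outside ∷ p) (outside ∷ q) = ∣p∪q∣≤∣p∣+∣q∣ p q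
∣p∪q∣≤∣p∣+∣q∣ (outside ∷ p) (inside  ∷ q) =
  ℕ.≤-trans (s≤s (∣p∪q∣≤∣p∣+∣q∣ p q)) (ℕ.≤-reflexive (sym (ℕ.+-suc ∣ p ∣ ∣ q ∣)))
∣p∪q∣≤∣p∣+∣q∣ (inside  ∷ p) (outside ∷ q) = s≤s (∣p∪q∣≤∣p∣+∣q∣ p q)
∣p∪q∣≤∣p∣+∣q∣ (inside  ∷ p) (inside  ∷ q) =
  s≤s (ℕ.≤-trans (∣p∪q∣≤∣p∣+∣q∣ p q) (ℕ.+-monoʳ-≤ ∣ p ∣ (ℕ.n≤1+n ∣ q ∣)))

∈-subsets : ∀ {n} (p : Subset n) → p ∈ˡ subsets n
∈-subsets []            = here refl
∈-subsets (inside  ∷ p) = ∈-++⁺ˡ (∈-map⁺ (inside ∷_) (∈-subsets p))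
∈-subsets (outside ∷ p) = ∈-++⁺ʳ (map (inside ∷_) (subsets _)) (∈-map⁺ (outside ∷_) (∈-subsets p))

-- Indicators as multiplicities

indicator : {P : Set} → Dec P → ℕ
indicator (yes _) = 1
indicator (no  _) = 0

indicator-yes : {P : Set} (p? : Dec P) → P → indicator p? ≡ 1
indicator-yes (yes _) _ = refl
indicator-yes (no ¬p) p = contradiction p ¬p

indicator-no : {P : Set} (p? : Dec P) → ¬ P → indicator p? ≡ 0
indicator-no (yes p) ¬p = contradiction p ¬p
indicator-no (no  _) _  = refl

indicator≥1 : {P : Set} (p? : Dec P) → P → 1 ℕ.≤ indicator p?
indicator≥1 p? p = ℕ.≤-reflexive (sym (indicator-yes p? p))

indicator≤ : {P : Set} (p? : Dec P) {n : ℕ} → (P → 1 ℕ.≤ n) → indicator p? ℕ.≤ n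
indicator≤ (yes p) f = f p
indicator≤ (no _)  f = z≤n

2*indicator≤ : {P : Set} (p? : Dec P) {n : ℕ} → (P → 2 ℕ.≤ n) → indicator p? ℕ.+ indicator p? ℕ.≤ n
2*indicator≤ (yes p) f = f p
2*indicator≤ (no _)  f = z≤n

≤2*indicator : {P : Set} (p? : Dec P) {n : ℕ} → n ℕ.≤ 2 → (1 ℕ.≤ n → P) → n ℕ.≤ indicator p? ℕ.+ indicator p?
≤2*indicator (yes _) n≤2 f = n≤2
≤2*indicator (no ¬p) n≤2 f = ℕ.≮⇒≥ (¬p ∘ f)

indicator-mono : {P Q : Set} (p? : Dec P) (q? : Dec Q) → (P → Q) → indicator p? ℕ.≤ indicator q?
indicator-mono p? q? f = indicator≤ p? (indicator≥1 q? ∘ f)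

-- Walks

module _ {G : Graph} where

  open DecMembership (_≟_ {#V G}) using () renaming (_∈?_ to _∈ˡ?_)

  joins-sym : ∀ {e u v} → Joins G e u v → Joins G e v u
  joins-sym (inj₁ p) = inj₂ p
  joins-sym (inj₂ p) = inj₁ p

  joins-ends : ∀ {e u v x y} → Joins G e u v → Joins G e x y → x ≡ u ⊎ x ≡ v
  joins-ends (inj₁ refl) (inj₁ refl) = inj₁ refl
  joins-ends (inj₁ refl) (inj₂ refl) = inj₂ refl
  joins-ends (inj₂ refl) (inj₁ refl) = inj₂ refl
  joins-ends (inj₂ refl) (inj₂ refl) = inj₁ refl

  walk-map : ∀ {P Q : Pred (E G) 0ℓ} {u v} → (∀ {e} → P e → Q e) → Walk G P u v → Walk G Q u v
  walk-map f nil            = nil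
  walk-map f (cons e p j w) = cons e (f p) j (walk-map f w)

  walkEdges-map : ∀ {P Q : Pred (E G) 0ℓ} {u v} (f : ∀ {e} → P e → Q e) (w : Walk G P u v) →
                  walkEdges G (walk-map {Q = Q} f w) ≡ walkEdges G w
  walkEdges-map f nil            = refl
  walkEdges-map f (cons e _ _ w) = cong (e ∷_) (walkEdges-map f w)

  walkVertices-map : ∀ {P Q : Pred (E G) 0ℓ} {u v} (f : ∀ {e} → P e → Q e) (w : Walk G P u v) →
                     walkVertices G (walk-map {Q = Q} f w) ≡ walkVertices G w
  walkVertices-map f nil                    = refl
  walkVertices-map f (cons {u = u} _ _ _ w) = cong (u ∷_) (walkVertices-map f w)

  append : ∀ {P u v w} → Walk G P u v → Walk G P v w → Walk G P u w
  append nil            q = q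
  append (cons e p j w) q = cons e p j (append w q)

  reverse : ∀ {P u v} → Walk G P u v → Walk G P v u
  reverse nil            = nil
  reverse (cons e p j w) = append (reverse w) (cons e p (joins-sym j) nil)

  ∈-walk⇒P : ∀ {P u v e} (w : Walk G P u v) → e ∈ˡ walkEdges G w → P e
  ∈-walk⇒P (cons _ p _ w) (here refl) = p
  ∈-walk⇒P (cons _ _ _ w) (there e∈w) = ∈-walk⇒P w e∈w

  restrict : ∀ {P Q : Pred (E G) 0ℓ} {u v} (w : Walk G P u v) →
             (∀ {e} → e ∈ˡ walkEdges G w → Q e) → Walk G Q u v
  restrict nil            f = nil
  restrict (cons e p j w) f = cons e (f (here refl)) j (restrict w (f ∘ there))

  -- unlike walkVertices, includes the final vertex
  stops : ∀ {P u v} → Walk G P u v → List (V G)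
  stops (nil {v})              = v ∷ []
  stops (cons {u = u} _ _ _ w) = u ∷ stops w

  first-stop : ∀ {P u v} (w : Walk G P u v) → u ∈ˡ stops w
  first-stop nil            = here refl
  first-stop (cons _ _ _ _) = here refl

  last-stop : ∀ {P u v} (w : Walk G P u v) → v ∈ˡ stops w
  last-stop nil            = here refl
  last-stop (cons _ _ _ w) = there (last-stop w)

  ends-are-stops : ∀ {P u v e x y} (w : Walk G P u v) →
                   e ∈ˡ walkEdges G w → Joins G e x y → x ∈ˡ stops w
  ends-are-stops (cons e _ j w) (here refl) j′ with joins-ends j j′
  ... | inj₁ refl = here refl
  ... | inj₂ refl = there (first-stop w)
  ends-are-stops (cons _ _ _ w) (there e∈w) j′ = there (ends-are-stops w e∈w j′)

  walkVertices⊆stops : ∀ {P u v x} (w : Walk G P u v) → x ∈ˡ walkVertices G w → x ∈ˡ stops w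
  walkVertices⊆stops (cons _ _ _ w) (here refl) = here refl
  walkVertices⊆stops (cons _ _ _ w) (there x∈w) = there (walkVertices⊆stops w x∈w)

  -- Paths

  Path : Pred (E G) 0ℓ → V G → V G → Set
  Path P u v = ∃ λ (w : Walk G P u v) → Unique (stops w)

  path-suffix : ∀ {P u v x} (p : Path P u v) → x ∈ˡ stops (proj₁ p) → Path P x v
  path-suffix p@(nil          , _)          (here refl) = p
  path-suffix p@(cons _ _ _ _ , _)          (here refl) = p
  path-suffix   (cons _ _ _ w , _ ∷ unique) (there x∈w) = path-suffix (w , unique) x∈w

  -- Loop erasure from the end: if the start already lies on the path found for the remainder, the
  -- suffix from there replaces the whole.
  walk⇒path : ∀ {P u v} → Walk G P u v → Path P u v
  walk⇒path nil = nil , [] ∷ []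
  walk⇒path {u = u} (cons e p j w) with walk⇒path w
  ... | q , unique with u ∈ˡ? stops q
  ...   | yes u∈q = path-suffix (q , unique) u∈q
  ...   | no  u∉q = cons e p j q , All.tabulate (λ { x∈q refl → u∉q x∈q }) ∷ unique

  -- If the first edge recurred, its end `u` would be a stop of the remainder.
  path-edges-unique : ∀ {P u v} (w : Walk G P u v) → Unique (stops w) → Unique (walkEdges G w)
  path-edges-unique nil            _            = []
  path-edges-unique (cons e _ j w) (u∉ ∷ unique) =
    All.tabulate (λ { f∈w refl → All.lookup u∉ (ends-are-stops w f∈w j) refl })
      ∷ path-edges-unique w unique

  path-end∉vertices : ∀ {P u v} (w : Walk G P u v) → Unique (stops w) → v ∉ˡ walkVertices G w
  path-end∉vertices (cons _ _ _ w) (u∉ ∷ unique) (here refl) = All.lookup u∉ (last-stop w) refl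
  path-end∉vertices (cons _ _ _ w) (u∉ ∷ unique) (there v∈w) = path-end∉vertices w unique v∈w

  path-vertices-unique : ∀ {P u v} (w : Walk G P u v) → Unique (stops w) → Unique (walkVertices G w)
  path-vertices-unique nil            _             = []
  path-vertices-unique (cons _ _ _ w) (u∉ ∷ unique) =
    All.tabulate (All.lookup u∉ ∘ walkVertices⊆stops w) ∷ path-vertices-unique w unique

  -- As no edge repeats, deleting the one occurrence of `e` leaves two pieces that avoid it; `x` and
  -- `y` are the ends of `e` in the order of traversal.
  split-at-edge : ∀ {P u v e} (w : Walk G P u v) → Unique (walkEdges G w) → e ∈ˡ walkEdges G w →
                  ∃₂ λ x y → Joins G e x y
                    × Walk G (λ f → P f × f ≢ e) u x × Walk G (λ f → P f × f ≢ e) y v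
  split-at-edge (cons {u = u} {v = x} _ _ j w) (e∉ ∷ unique) (here refl) =
    u , x , j , nil , restrict w (λ f∈w → ∈-walk⇒P w f∈w , λ { refl → All.lookup e∉ f∈w refl })
  split-at-edge (cons f pf j w) (f∉ ∷ unique) (there e∈w) =
    let x , y , j′ , p , q = split-at-edge w unique e∈w
    in  x , y , j′ , cons f (pf , All.lookup f∉ e∈w) j p , q

  -- Edge multiplicities and tours

  count : ∀ {P u v} → Walk G P u v → E G → ℕ
  count nil            f = 0
  count (cons e _ _ w) f = indicator (e ≟ f) ℕ.+ count w f

  count-append : ∀ {P u v x} (p : Walk G P u v) (q : Walk G P v x) e →
                 count (append p q) e ≡ count p e ℕ.+ count q e
  count-append nil            q e = refl
  count-append (cons f _ _ p) q e =
    trans (cong (indicator (f ≟ e) ℕ.+_) (count-append p q e))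
          (sym (ℕ.+-assoc (indicator (f ≟ e)) (count p e) (count q e)))

  ∈-walk⇒count≥1 : ∀ {P u v e} (w : Walk G P u v) → e ∈ˡ walkEdges G w → 1 ℕ.≤ count w e
  ∈-walk⇒count≥1 {e = e} (cons _ _ _ w) (here refl) =
    ℕ.≤-trans (indicator≥1 (e ≟ e) refl) (ℕ.m≤m+n _ (count w e))
  ∈-walk⇒count≥1 {e = e} (cons f _ _ w) (there e∈w) =
    ℕ.≤-trans (∈-walk⇒count≥1 w e∈w) (ℕ.m≤n+m (count w e) (indicator (f ≟ e)))

  count≥1⇒∈-walk : ∀ {P u v e} (w : Walk G P u v) → 1 ℕ.≤ count w e → e ∈ˡ walkEdges G w
  count≥1⇒∈-walk {e = e} (cons f _ _ w) c≥1 with f ≟ e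
  ... | yes refl = here refl
  ... | no  _    = there (count≥1⇒∈-walk w c≥1)

  detour : ∀ {P u v x y e} (w : Walk G P u v) → x ∈ˡ stops w → P e → Joins G e x y → Walk G P u v
  detour {e = e} nil                (here refl) p j = cons e p j (cons e p (joins-sym j) nil)
  detour {e = e} w@(cons _ _ _ _)   (here refl) p j = cons e p j (cons e p (joins-sym j) w)
  detour         (cons f q j′ w)    (there x∈w) p j = cons f q j′ (detour w x∈w p j)

  module _ {P : Pred (E G) 0ℓ} {x y e} (p : P e) (j : Joins G e x y) where

    detour-keeps : ∀ {u v z} (w : Walk G P u v) (x∈w : x ∈ˡ stops w) →
                   z ∈ˡ stops w → z ∈ˡ stops (detour w x∈w p j)
    detour-keeps nil            (here refl) z∈w         = there (there z∈w)
    detour-keeps (cons _ _ _ w) (here refl) z∈w         = there (there z∈w)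
    detour-keeps (cons _ _ _ w) (there x∈w) (here refl) = here refl
    detour-keeps (cons _ _ _ w) (there x∈w) (there z∈w) = there (detour-keeps w x∈w z∈w)

    detour-visits : ∀ {u v} (w : Walk G P u v) (x∈w : x ∈ˡ stops w) → y ∈ˡ stops (detour w x∈w p j)
    detour-visits nil            (here refl) = there (here refl)
    detour-visits (cons _ _ _ w) (here refl) = there (here refl)
    detour-visits (cons _ _ _ w) (there x∈w) = there (detour-visits w x∈w)

    -- The nested sum is what `count` computes to when the detour is made at the start, so those
    -- cases are `refl`; at a later position both indicators only have to be moved past the first
    -- summand.
    count-detour : ∀ {u v} (w : Walk G P u v) (x∈w : x ∈ˡ stops w) f →
                   count (detour w x∈w p j) f ≡ indicator (e ≟ f) ℕ.+ (indicator (e ≟ f) ℕ.+ count w f)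
    count-detour nil            (here refl) f = refl
    count-detour (cons _ _ _ w) (here refl) f = refl
    count-detour (cons g _ _ w) (there x∈w) f =
      trans (cong (indicator (g ≟ f) ℕ.+_) (count-detour w x∈w f))
        (trans (x∙yz≈y∙xz (indicator (g ≟ f)) i _) (cong (i ℕ.+_) (x∙yz≈y∙xz (indicator (g ≟ f)) i _)))
      where
      i = indicator (e ≟ f)
      open CommutativeSemigroupProperties ℕ.+-commutativeSemigroup using (x∙yz≈y∙xz)

  -- Doubling every edge of a spanning tree yields such a closed walk. Bounding the multiplicities
  -- directly avoids constructing the spanning tree.
  record Tour (P : Pred (E G) 0ℓ) (u : V G) : Set where
    constructor tour
    field
      walk    : Walk G P u u
      count≤2 : ∀ e → count walk e ℕ.≤ 2

  open Tour public

  -- A new vertex is reached by an edge not yet used, traversed back and forth.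
  visit-next : ∀ {P u x y e} (t : Tour P u) → x ∈ˡ stops (walk t) → P e → Joins G e x y →
               ∃ λ (t′ : Tour P u) → y ∈ˡ stops (walk t′)
                 × (∀ {z} → z ∈ˡ stops (walk t) → z ∈ˡ stops (walk t′))
  visit-next {y = y} {e} t@(tour w c≤2) x∈w p j with y ∈ˡ? stops w
  ... | yes y∈w = t , y∈w , id
  ... | no  y∉w = tour (detour w x∈w p j) count′≤2 , detour-visits p j w x∈w , detour-keeps p j w x∈w
    where
    unused : count w e ℕ.≤ 0
    unused = ℕ.≮⇒≥ λ c≥1 → y∉w (ends-are-stops w (count≥1⇒∈-walk w c≥1) (joins-sym j))
    count′≤2 : ∀ f → count (detour w x∈w p j) f ℕ.≤ 2
    count′≤2 f rewrite count-detour p j w x∈w f with e ≟ f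
    ... | yes refl = s≤s (s≤s unused)
    ... | no  _    = c≤2 f

  visit : ∀ {P u x y} (t : Tour P u) → x ∈ˡ stops (walk t) → Walk G P x y →
          ∃ λ (t′ : Tour P u) → y ∈ˡ stops (walk t′)
            × (∀ {z} → z ∈ˡ stops (walk t) → z ∈ˡ stops (walk t′))
  visit t x∈t nil            = t , x∈t , id
  visit t x∈t (cons e p j w) =
    let t₁ , y∈t₁ , keeps₁ = visit-next t x∈t p j
        t₂ , z∈t₂ , keeps₂ = visit t₁ y∈t₁ w
    in  t₂ , z∈t₂ , keeps₂ ∘ keeps₁

  -- The trivial tour is extended by one target at a time. The walk to each new target begins at
  -- `u`, which every tour visits, and extensions never lose a stop.
  tour-through : ∀ {P u} (vs : List (V G)) → (∀ {v} → v ∈ˡ vs → Walk G P u v) →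
                 ∃ λ (t : Tour P u) → ∀ {v} → v ∈ˡ vs → v ∈ˡ stops (walk t)
  tour-through []       reach = tour nil (λ _ → z≤n) , λ ()
  tour-through (v ∷ vs) reach with tour-through vs (reach ∘ there)
  ... | t , visits with visit t (first-stop (walk t)) (reach (here refl))
  ...   | t′ , v∈t′ , keeps = t′ , λ { (here refl) → v∈t′ ; (there x∈vs) → keeps (visits x∈vs) }

-- Weights

module Steiner {G : Graph} (ℓ : LengthFunction G) where

  weightOn : List (E G) → (E G → ℕ) → ℝ
  weightOn []       c = 0ℝ
  weightOn (e ∷ es) c = c e · len ℓ e + weightOn es c

  weight : (E G → ℕ) → ℝ
  weight = weightOn (allFin (#E G))

  weightOn-mono : ∀ es {c d} → (∀ e → c e ℕ.≤ d e) → weightOn es c ≤ weightOn es d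
  weightOn-mono []       c≤d = ≤-refl {0ℝ}
  weightOn-mono (e ∷ es) {c} {d} c≤d =
    +-mono-≤ {c e · len ℓ e} {d e · len ℓ e} {weightOn es c} {weightOn es d}
      (·-monoˡ-≤ (len ℓ e) (positive⇒nonnegative {len ℓ e} (positive ℓ e)) (c≤d e))
      (weightOn-mono es c≤d)

  seq-weightOn-+ : ∀ es c d k →
    seq (weightOn es (λ e → c e ℕ.+ d e)) k ≡ seq (weightOn es c) k ℚ.+ seq (weightOn es d) k
  seq-weightOn-+ []       c d k = refl
  seq-weightOn-+ (e ∷ es) c d k =
    trans (cong₂ ℚ._+_ (·-distribʳ-+ (len ℓ e) (c e) (d e) k) (seq-weightOn-+ es c d k))
          (interchange (seq (c e · len ℓ e) k) (seq (d e · len ℓ e) k)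
                       (seq (weightOn es c) k) (seq (weightOn es d) k))
    where
    interchange : ∀ p q r s → (p ℚ.+ q) ℚ.+ (r ℚ.+ s) ≡ (p ℚ.+ r) ℚ.+ (q ℚ.+ s)
    interchange = solve 4 (λ p q r s → (p :+ q) :+ (r :+ s) := (p :+ r) :+ (q :+ s)) refl
      where open +-*-Solver

  lengthSum : List (E G) → ℝ
  lengthSum = foldr (λ e r → len ℓ e + r) 0ℝ

  -- Links `totalLength`, a sum over a filtered list, to a 0-1 weight over all edges. The two sides
  -- differ only by zeros: one inside `1 · len ℓ e` for each accepted edge, one as the term of each
  -- rejected edge.
  seq-weightOn-filter : ∀ {P : Pred (E G) 0ℓ} (P? : Decidable P) es k →
    seq (lengthSum (filter P? es)) k ≡ seq (weightOn es (indicator ∘ P?)) k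
  seq-weightOn-filter     P? []       k = refl
  seq-weightOn-filter {P} P? (e ∷ es) k = step (P? e)
    where
    rest = seq (weightOn es (indicator ∘ P?)) k
    term : ℕ → ℚ
    term m = seq (m · len ℓ e) k

    step : Dec (P e) → seq (lengthSum (filter P? (e ∷ es))) k ≡ term (indicator (P? e)) ℚ.+ rest
    step (yes p) = begin
      seq (lengthSum (filter P? (e ∷ es))) k                ≡⟨ cong (λ xs → seq (lengthSum xs) k) (filter-accept P? p) ⟩
      seq (len ℓ e) k ℚ.+ seq (lengthSum (filter P? es)) k  ≡⟨ cong (seq (len ℓ e) k ℚ.+_) (seq-weightOn-filter P? es k) ⟩
      seq (len ℓ e) k ℚ.+ rest                              ≡⟨ cong (ℚ._+ rest) (ℚ.+-identityʳ (seq (len ℓ e) k)) ⟨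
      term 1 ℚ.+ rest                                       ≡⟨ cong (λ m → term m ℚ.+ rest) (indicator-yes (P? e) p) ⟨
      term (indicator (P? e)) ℚ.+ rest                      ∎
      where open ≡-Reasoning
    step (no ¬p) = begin
      seq (lengthSum (filter P? (e ∷ es))) k  ≡⟨ cong (λ xs → seq (lengthSum xs) k) (filter-reject P? ¬p) ⟩
      seq (lengthSum (filter P? es)) k        ≡⟨ seq-weightOn-filter P? es k ⟩
      rest                                    ≡⟨ ℚ.+-identityˡ rest ⟨
      term 0 ℚ.+ rest                         ≡⟨ cong (λ m → term m ℚ.+ rest) (indicator-no (P? e) ¬p) ⟨
      term (indicator (P? e)) ℚ.+ rest        ∎
      where open ≡-Reasoning

  weight-+ : ∀ c d → weight (λ e → c e ℕ.+ d e) ≐ weight c + weight d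
  weight-+ c d = mk≐ (seq-weightOn-+ (allFin (#E G)) c d)

  infix 4 _≼_

  -- Weaker than edgewise comparison: a walk of `G` need not use the edges of `T` at all, so
  -- geodesicity can only compare total weights.
  record _≼_ (c d : E G → ℕ) : Set where
    constructor mk≼
    field
      weight-≤ : weight c ≤ weight d

  open _≼_ public

  ≤⇒≼ : ∀ {c d} → (∀ e → c e ℕ.≤ d e) → c ≼ d
  ≤⇒≼ c≤d = mk≼ (weightOn-mono (allFin (#E G)) c≤d)

  ≼-trans : ∀ {b c d} → b ≼ c → c ≼ d → b ≼ d
  ≼-trans {b} {c} {d} b≼c c≼d =
    mk≼ (≤-trans {weight b} {weight c} {weight d} (weight-≤ b≼c) (weight-≤ c≼d))

  ≼-+ : ∀ {a b c d} → a ≼ c → b ≼ d → (λ e → a e ℕ.+ b e) ≼ (λ e → c e ℕ.+ d e)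
  ≼-+ {a} {b} {c} {d} a≼c b≼d = mk≼
    (≤-trans {y = weight a + weight b} (≐⇒≤ (weight-+ a b))
      (≤-trans {y = weight c + weight d}
        (+-mono-≤ {weight a} {weight c} {weight b} {weight d} (weight-≤ a≼c) (weight-≤ b≼d))
        (≐⇒≤ (≐-sym (weight-+ c d)))))

  ≼-double-cancel : ∀ {c d} → (λ e → c e ℕ.+ c e) ≼ (λ e → d e ℕ.+ d e) → c ≼ d
  ≼-double-cancel {c} {d} 2c≼2d = mk≼ (double-cancel-≤ {weight c} {weight d}
    (≤-trans {y = weight (λ e → c e ℕ.+ c e)} (≐⇒≤ (≐-sym (weight-+ c c)))
      (≤-trans {y = weight (λ e → d e ℕ.+ d e)} (weight-≤ 2c≼2d) (≐⇒≤ (weight-+ d d)))))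

  edgeIndicator : Subgraph G → E G → ℕ
  edgeIndicator S e = indicator (e ∈? edges S)

  totalLength-weight : ∀ S → totalLength ℓ S ≐ weight (edgeIndicator S)
  totalLength-weight S = mk≐ (seq-weightOn-filter (_∈? edges S) (allFin (#E G)))

  totalLength≤weight : ∀ S {c} → edgeIndicator S ≼ c → totalLength ℓ S ≤ weight c
  totalLength≤weight S {c} S≼c =
    ≤-trans {y = weight (edgeIndicator S)} (≐⇒≤ (totalLength-weight S)) (weight-≤ S≼c)

  weight≤totalLength : ∀ S {c} → c ≼ edgeIndicator S → weight c ≤ totalLength ℓ S
  weight≤totalLength S {c} c≼S =
    ≤-trans {y = weight (edgeIndicator S)} (weight-≤ c≼S) (≐⇒≤ (≐-sym (totalLength-weight S)))

  totalLength-mono : ∀ S S′ → edgeIndicator S ≼ edgeIndicator S′ → totalLength ℓ S ≤ totalLength ℓ S′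
  totalLength-mono S S′ S≼S′ =
    ≤-trans {y = weight (edgeIndicator S′)} (totalLength≤weight S S≼S′)
      (≐⇒≤ (≐-sym (totalLength-weight S′)))

  -- Steiner distance

  -- The closedness proof found by toSubgraph need not be the one stored in S.
  toSubgraph-just : (S : Subgraph G) → ∃ λ S′ →
    toSubgraph G (vertices S , edges S) ≡ just S′ × vertices S′ ≡ vertices S × edges S′ ≡ edges S
  toSubgraph-just S
    with Lift? (λ e → (proj₁ (ends G e) ∈? vertices S) ×-dec (proj₂ (ends G e) ∈? vertices S)) (edges S)
  ... | yes c = mkSubgraph (vertices S) (edges S) c , refl , refl , refl
  ... | no ¬c = ⊥-elim (¬c (closed S))

  ∈-subgraphs : (S : Subgraph G) → ∃ λ S′ →
    S′ ∈ˡ subgraphs G × vertices S′ ≡ vertices S × edges S′ ≡ edges S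
  ∈-subgraphs S =
    let S′ , eq , same = toSubgraph-just S
    in  S′ , Any.mapMaybe⁺ (toSubgraph G) _
          (Any.map⁺ (lose (∈-cartesianProduct⁺ (∈-subsets (vertices S)) (∈-subsets (edges S)))
            (subst (Maybe.Any (S′ ≡_)) (sym eq) (Maybe.just refl)))) , same

  -- `Connects` depends on the vertex and edge sets only, so two subgraphs differing in their
  -- closedness proofs share the evidence.
  connects-resp : ∀ {H A} (S S′ : Subgraph G) → vertices S′ ≡ vertices S → edges S′ ≡ edges S →
                  Connects ℓ H A S → Connects ℓ H A S′
  connects-resp (mkSubgraph _ _ _) (mkSubgraph _ _ _) refl refl S-connects = S-connects

  totalLength-resp : ∀ (S S′ : Subgraph G) → edges S′ ≡ edges S → totalLength ℓ S′ ≡ totalLength ℓ S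
  totalLength-resp S S′ = cong (lengthSum ∘ edgeList G)

  -- Together with `sd-glb` this characterises `sd` as an infimum, which hides the enumeration of
  -- subgraphs from the rest of the proof.
  sd-≤ : ∀ H A S → Connects ℓ H A S → sd ℓ H A ≤∞ fin (totalLength ℓ S)
  sd-≤ H A S S-connects =
    let S′ , S′∈ , same-vertices , same-edges = ∈-subgraphs S
        S′-connects = connects-resp {H} {A} S S′ same-vertices same-edges S-connects
    in  subst (λ x → sd ℓ H A ≤∞ fin x) (totalLength-resp S S′ same-edges)
          (minimum-≤ (∈-map⁺ (totalLength ℓ) (∈-filter⁺ (connects? ℓ H A) S′∈ S′-connects)))

  sd-glb : ∀ H A {y} → (∀ S → Connects ℓ H A S → y ≤∞ fin (totalLength ℓ S)) → y ≤∞ sd ℓ H A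
  sd-glb H A {y} lower = minimum-glb {y} (map (totalLength ℓ) candidates) λ x∈ →
    let S , S∈ , x≡ = ∈-map⁻ (totalLength ℓ) x∈
    in  subst (λ x → y ≤∞ fin x) (sym x≡)
          (lower S (proj₂ (∈-filter⁻ (connects? ℓ H A) {xs = subgraphs G} S∈)))
    where
    candidates : List (Subgraph G)
    candidates = filter (connects? ℓ H A) (subgraphs G)

-- Components of edge sets

module _ {G : Graph} (F : Subset (#E G)) (u : V G) where

  private
    reached? = walk? G F u
    used?    = λ e → (e ∈? F) ×-dec reached? (proj₁ (ends G e))

  -- It suffices to test one end of an edge of `F`: the other end is then reached along that edge.
  component : Subgraph G
  component = mkSubgraph (comprehension reached?) (comprehension used?) λ {e} e∈ →
    let e∈F , w = ∈-comprehension⁻ used? e∈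
    in  ∈-comprehension⁺ reached? w
      , ∈-comprehension⁺ reached? (append w (cons e e∈F (inj₁ refl) nil))

  ∈-component⁺ : ∀ {v} → Walk G (_∈ F) u v → v ∈ vertices component
  ∈-component⁺ = ∈-comprehension⁺ reached?

  ∈-component⁻ : ∀ {v} → v ∈ vertices component → Walk G (_∈ F) u v
  ∈-component⁻ = ∈-comprehension⁻ reached?

  component-edges⊆ : edges component ⊆ F
  component-edges⊆ e∈ = proj₁ (∈-comprehension⁻ used? e∈)

  walk-in-component : ∀ {x y} → Walk G (_∈ F) u x → Walk G (_∈ F) x y → WalkIn component x y
  walk-in-component r nil                       = nil
  walk-in-component r (cons e e∈F (inj₁ refl) w) =
    cons e (∈-comprehension⁺ used? (e∈F , r)) (inj₁ refl)
      (walk-in-component (append r (cons e e∈F (inj₁ refl) nil)) w)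
  -- The end tested by `used?` is now the next vertex of the walk, so reachability is first extended
  -- across `e`.
  walk-in-component r (cons e e∈F (inj₂ refl) w) =
    let r′ = append r (cons e e∈F (inj₂ refl) nil)
    in  cons e (∈-comprehension⁺ used? (e∈F , r′)) (inj₂ refl) (walk-in-component r′ w)

  component-connected : Connected component
  component-connected = (u , ∈-component⁺ nil) , λ x y x∈ y∈ →
    let p = ∈-component⁻ x∈
    in  walk-in-component p (append (reverse p) (∈-component⁻ y∈))

walk-stays : ∀ {G} {H : Subgraph G} {u v} → u ∈ vertices H → WalkIn H u v → v ∈ vertices H
walk-stays         u∈H nil                        = u∈H
walk-stays {H = H} u∈H (cons e e∈H (inj₁ refl) w) = walk-stays {H = H} (proj₂ (closed H e∈H)) w
walk-stays {H = H} u∈H (cons e e∈H (inj₂ refl) w) = walk-stays {H = H} (proj₁ (closed H e∈H)) w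

component-⊑ : ∀ {G} {H : Subgraph G} {F u} → F ⊆ edges H → u ∈ vertices H → component F u ⊑ H
component-⊑ {H = H} {F} {u} F⊆H u∈H =
  (λ v∈ → walk-stays {H = H} u∈H (walk-map F⊆H (∈-component⁻ F u v∈))) ,
  (λ e∈ → F⊆H (component-edges⊆ F u e∈))

⊑-whole : ∀ {G} (H : Subgraph G) → H ⊑ whole G
⊑-whole H = (λ _ → ∈⊤) , (λ _ → ∈⊤)

-- Separation by the edges of a tree

module _ {G : Graph} (T : Subgraph G) where

  private
    other? : ∀ e → Decidable (λ f → f ∈ edges T × f ≢ e)
    other? e f = (f ∈? edges T) ×-dec ¬? (f ≟ e)

  without : E G → Subset (#E G)
  without e = comprehension (other? e)

  ∈-without⁺ : ∀ {e f} → f ∈ edges T × f ≢ e → f ∈ without e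
  ∈-without⁺ {e} = ∈-comprehension⁺ (other? e)

  ∈-without⁻ : ∀ {e f} → f ∈ without e → f ∈ edges T × f ≢ e
  ∈-without⁻ {e} = ∈-comprehension⁻ (other? e)

  -- Defined by walks in `T` minus `e` instead of by the tree path from `u` to `v`, so that symmetry
  -- and the triangle inequality follow by reversing and concatenating walks.
  Separates : E G → V G → V G → Set
  Separates e u v = ¬ Walk G (_∈ without e) u v

  separates? : ∀ e u v → Dec (Separates e u v)
  separates? e u v = ¬? (walk? G (without e) u v)

  -- For vertices `u`, `v` of a tree `T` this is the indicator of the edge set of the `u`-`v` path;
  -- for fixed `e` it is a pseudometric on the vertices.
  sep : V G → V G → E G → ℕ
  sep u v e = indicator (separates? e u v)

  sep-sym : ∀ u v e → sep u v e ℕ.≤ sep v u e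
  sep-sym u v e = indicator-mono (separates? e u v) (separates? e v u) (λ s w → s (reverse w))

  sep-refl : ∀ v e → sep v v e ℕ.≤ 0
  sep-refl v e = indicator≤ (separates? e v v) λ s → contradiction nil s

  sep-triangle : ∀ u v w e → sep u w e ℕ.≤ sep u v e ℕ.+ sep v w e
  sep-triangle u v w e = indicator≤ (separates? e u w) split
    where
    split : Separates e u w → 1 ℕ.≤ sep u v e ℕ.+ sep v w e
    split s with walk? G (without e) u v
    ... | no  _ = s≤s z≤n
    ... | yes p = indicator≥1 (separates? e v w) (λ q → s (append p q))

  -- Otherwise the walk in `S` would avoid `e` and connect `u` to `v` in `T` minus `e`.
  separating-edge-used : ∀ {S : Subgraph G} {e u v} → S ⊑ T → WalkIn S u v → Separates e u v → e ∈ edges S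
  separating-edge-used {S} {e} S⊑T w s with e ∈? edges S
  ... | yes e∈S = e∈S
  ... | no  e∉S = ⊥-elim (s (walk-map (λ f∈S → ∈-without⁺ (proj₂ S⊑T f∈S , λ { refl → e∉S f∈S })) w))

  module _ (acyclic : Acyclic T) where

    -- A walk from `y` to `x` avoiding `e` contains a path, which `e` closes to a cycle of `T`. The
    -- start `x` is not repeated on that cycle, since `walkVertices` omits the final vertex of the
    -- path.
    edge-separates-ends : ∀ {e x y} → e ∈ edges T → Joins G e x y → Separates e y x
    edge-separates-ends {e} e∈T j w with walk⇒path (walk-map ∈-without⁻ w)
    ... | q , unique = acyclic (cons e e∈T j (walk-map proj₁ q))
      ( (λ ())
      , subst (Unique ∘ (e ∷_)) (sym (walkEdges-map proj₁ q))
          (All.tabulate (λ { f∈q refl → proj₂ (∈-walk⇒P q f∈q) refl }) ∷ path-edges-unique q unique)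
      , subst (Unique ∘ (_ ∷_)) (sym (walkVertices-map proj₁ q))
          (All.tabulate (λ { x∈q refl → path-end∉vertices q unique x∈q }) ∷ path-vertices-unique q unique) )

    -- If a walk `w` from `u` to `v` avoided `e`, then following the path from `y` to `v`, `w`
    -- backwards to `u`, and the path on to `x` would join the ends of `e` without `e`.
    path-edges-separate : ∀ {u v e} (p : Path (_∈ edges T) u v) → e ∈ˡ walkEdges G (proj₁ p) → Separates e u v
    path-edges-separate (p , unique) e∈p w =
      let x , y , j , u⇝x , y⇝v = split-at-edge p (path-edges-unique p unique) e∈p
      in  edge-separates-ends (∈-walk⇒P p e∈p) j
            (append (walk-map ∈-without⁺ y⇝v) (append (reverse w) (walk-map ∈-without⁺ u⇝x)))

-- Cutting walks at the vertices of the tree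

module _ {G : Graph} (ℓ : LengthFunction G) (T : Subgraph G) (2-geodesic : Geodesic ℓ 2 T) where

  open Steiner ℓ

  -- The edges of `w` form a connected subgraph `K` containing `u` and `v`, so the distance of these
  -- in `G` is at most the length of `w`. By 2-geodesicity it is also their distance in `T`, where
  -- every connecting subgraph contains all separating edges.
  sep≼walk : ∀ {P u v} → u ∈ vertices T → v ∈ vertices T → (w : Walk G P u v) →
                    sep T u v ≼ count w
  sep≼walk {u = u} {v} u∈T v∈T w = mk≼ (fin⁻¹
    (≤∞-trans (sd-glb T A below)
    (≤∞-trans (≈∞⇒≤∞ (2-geodesic A A⊆T ∣A∣≤2))
    (≤∞-trans (sd-≤ (whole G) A K (⊑-whole K , A⊆K , component-connected F u))
      (fin (totalLength≤weight K (≤⇒≼ K≤w)))))))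
    where
    A = ⁅ u ⁆ ∪ ⁅ v ⁆
    onWalk? : Decidable (_∈ˡ walkEdges G w)
    onWalk? e = DecMembership._∈?_ _≟_ e (walkEdges G w)
    F = comprehension onWalk?
    K = component F u

    A-elim : (Q : Pred (V G) 0ℓ) → Q u → Q v → ∀ {x} → x ∈ A → Q x
    A-elim Q qu qv x∈A with x∈p∪q⁻ ⁅ u ⁆ ⁅ v ⁆ x∈A
    ... | inj₁ x∈ = subst Q (sym (x∈⁅y⁆⇒x≡y u x∈)) qu
    ... | inj₂ x∈ = subst Q (sym (x∈⁅y⁆⇒x≡y v x∈)) qv

    A⊆T : A ⊆ vertices T
    A⊆T = A-elim (_∈ vertices T) u∈T v∈T

    A⊆K : A ⊆ vertices K
    A⊆K = A-elim (_∈ vertices K) (∈-component⁺ F u nil)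
      (∈-component⁺ F u (restrict w (∈-comprehension⁺ onWalk?)))

    ∣A∣≤2 : ∣ A ∣ ℕ.≤ 2
    ∣A∣≤2 = subst₂ (λ m n → ∣ A ∣ ℕ.≤ m ℕ.+ n) (∣⁅x⁆∣≡1 u) (∣⁅x⁆∣≡1 v) (∣p∪q∣≤∣p∣+∣q∣ ⁅ u ⁆ ⁅ v ⁆)

    K≤w : ∀ e → edgeIndicator K e ℕ.≤ count w e
    K≤w e = indicator≤ (e ∈? edges K) λ e∈K →
      ∈-walk⇒count≥1 w (∈-comprehension⁻ onWalk? (component-edges⊆ F u e∈K))

    below : ∀ S → Connects ℓ T A S → fin (weight (sep T u v)) ≤∞ fin (totalLength ℓ S)
    below S (S⊑T , A⊆S , connected) = fin (weight≤totalLength S (≤⇒≼ λ e →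
      indicator-mono (separates? T e u v) (e ∈? edges S) (separating-edge-used T {S} S⊑T u⇝v)))
      where
      u⇝v = proj₂ connected u v (A⊆S (x∈p∪q⁺ (inj₁ (x∈⁅x⁆ u)))) (A⊆S (x∈p∪q⁺ (inj₂ (x∈⁅x⁆ v))))

  -- Cut the walk at each of its vertices in T and apply sep≼walk to the pieces;
  -- q is the piece currently being traversed.
  Pieces : ∀ {P u x v} → Walk G P u x → Walk G P x v → Set
  Pieces {u = u} {v = v} q p = ∃ λ c → c ≼ (λ e → count q e ℕ.+ count p e)
    × (∀ {a} → a ∈ vertices T → a ∈ˡ stops p → ∀ e → sep T u a e ℕ.+ sep T a v e ℕ.≤ c e)

  -- The multiplicity `c` is the sum of `sep` over the pieces. For a cut vertex `a`, the triangle
  -- inequality bounds `sep T u a` by the pieces before `a` and `sep T a v` by those after it.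
  cut-walk : ∀ {P u x v} → u ∈ vertices T → v ∈ vertices T → (q : Walk G P u x) (p : Walk G P x v) →
             Pieces q p
  cut-walk {u = u} {v = v} u∈T v∈T q nil =
    sep T u v ,
    ≼-trans (sep≼walk u∈T v∈T q) (≤⇒≼ λ e → ℕ.m≤m+n (count q e) 0) ,
    λ { _ (here refl) e → ℕ.≤-trans (ℕ.+-monoʳ-≤ (sep T u v e) (sep-refl T v e))
                            (ℕ.≤-reflexive (ℕ.+-identityʳ (sep T u v e))) }
  cut-walk {u = u} {x} {v} u∈T v∈T q (cons e pe j p) = step (x ∈? vertices T)
    where
    step : Dec (x ∈ vertices T) → Pieces q (cons e pe j p)
    -- No cut at `x`: the edge `e` is moved onto the current piece.
    step (no x∉T) =
      let c , c≼ , ≤c = cut-walk u∈T v∈T (append q (cons e pe j nil)) p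
      in  c ,
          ≼-trans c≼ (≤⇒≼ λ f → ℕ.≤-reflexive (trans
            (cong (ℕ._+ count p f) (count-append q (cons e pe j nil) f))
            (trans (ℕ.+-assoc (count q f) (indicator (e ≟ f) ℕ.+ 0) (count p f))
              (cong (λ k → count q f ℕ.+ (k ℕ.+ count p f)) (ℕ.+-identityʳ (indicator (e ≟ f))))))) ,
          λ { a∈T (here refl) → contradiction a∈T x∉T ; a∈T (there a∈p) → ≤c a∈T a∈p }
    -- The piece `q` ends at `x`, and a new one starts there with `e`.
    step (yes x∈T) =
      let c , c≼ , ≤c = cut-walk x∈T v∈T (cons e pe j nil) p
      in  (λ f → sep T u x f ℕ.+ c f) ,
          ≼-trans (≼-+ (sep≼walk u∈T x∈T q) c≼) (≤⇒≼ λ f → ℕ.≤-reflexive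
            (cong (λ k → count q f ℕ.+ (k ℕ.+ count p f)) (ℕ.+-identityʳ (indicator (e ≟ f))))) ,
          -- For the cut vertex `x` itself, the induction hypothesis is applied to the last stop
          -- `v`, which bounds `sep T x v` by `c`.
          λ { _ (here refl) f → ℕ.+-monoʳ-≤ (sep T u x f)
                (ℕ.≤-trans (ℕ.m≤m+n (sep T x v f) _) (≤c v∈T (last-stop p) f))
            ; {a} a∈T (there a∈p) f → ℕ.≤-trans
                (ℕ.+-monoˡ-≤ (sep T a v f) (sep-triangle T u x a f))
                (ℕ.≤-trans (ℕ.≤-reflexive (ℕ.+-assoc (sep T u x f) (sep T x a f) (sep T a v f)))
                  (ℕ.+-monoʳ-≤ (sep T u x f) (≤c a∈T a∈p f))) }

  -- Steiner trees inside the tree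

  module _ (tree : IsTree T) {A : Subset (#V G)} (A⊆T : A ⊆ vertices T) where

    -- For `a` in `A`, these are the edges of the union of the tree paths from `a` to the vertices
    -- of `A`. Phrased by separation, each edge comes with a witness `b` for counting it on both
    -- sides of `b`.
    SeparatesFromA : V G → E G → Set
    SeparatesFromA a e = e ∈ edges T × ∃ λ b → b ∈ A × Separates T e a b

    separatesFromA? : ∀ a → Decidable (SeparatesFromA a)
    separatesFromA? a e = (e ∈? edges T) ×-dec any? (λ b → (b ∈? A) ×-dec separates? T e a b)

    steinerEdges : V G → Subset (#E G)
    steinerEdges a = comprehension (separatesFromA? a)

    steinerTree : V G → Subgraph G
    steinerTree a = component (steinerEdges a) a

    -- Every edge of the path of `T` from `a` to some `b` in `A` separates these two, so the whole
    -- path lies in `steinerEdges a`.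
    steinerTree-connects : ∀ {a} → a ∈ A → Connects ℓ T A (steinerTree a)
    steinerTree-connects {a} a∈A =
      component-⊑ {H = T} (λ e∈F → proj₁ (∈-comprehension⁻ (separatesFromA? a) e∈F)) (A⊆T a∈A) ,
      A⊆K , component-connected F a
      where
      F = steinerEdges a
      A⊆K : A ⊆ vertices (steinerTree a)
      A⊆K {b} b∈A =
        let p = walk⇒path (proj₂ (proj₁ tree) a b (A⊆T a∈A) (A⊆T b∈A))
        in  ∈-component⁺ F a (restrict (proj₁ p) λ e∈p → ∈-comprehension⁺ (separatesFromA? a)
              (∈-walk⇒P (proj₁ p) e∈p , b , b∈A , path-edges-separate T (proj₂ tree) p e∈p))

    -- A closed walk crosses every separating edge once on the way out and once on the way back.
    steinerTree≼ : ∀ {a} S (t : Tour (_∈ edges S) a) → (∀ {b} → b ∈ A → b ∈ˡ stops (walk t)) →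
                   Pieces (nil {v = a}) (walk t) → edgeIndicator (steinerTree a) ≼ edgeIndicator S
    steinerTree≼ {a} S t visits (c , c≼t , ≤c) =
      ≼-double-cancel (≼-trans (≤⇒≼ 2K≤c) (≼-trans c≼t (≤⇒≼ t≤2S)))
      where
      K = steinerTree a
      2K≤c : ∀ e → edgeIndicator K e ℕ.+ edgeIndicator K e ℕ.≤ c e
      2K≤c e = 2*indicator≤ (e ∈? edges K) λ e∈K →
        let _ , b , b∈A , s = ∈-comprehension⁻ (separatesFromA? a) (component-edges⊆ (steinerEdges a) a e∈K)
            sep≥1 = indicator≥1 (separates? T e a b) s
        in  ℕ.≤-trans (ℕ.+-mono-≤ sep≥1 (ℕ.≤-trans sep≥1 (sep-sym T a b e)))
                      (≤c (A⊆T b∈A) (visits b∈A) e)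

      t≤2S : ∀ e → count (walk t) e ℕ.≤ edgeIndicator S e ℕ.+ edgeIndicator S e
      t≤2S e = ≤2*indicator (e ∈? edges S) (count≤2 t e) λ c≥1 →
        ∈-walk⇒P (walk t) (count≥1⇒∈-walk (walk t) c≥1)

    steinerTree-shortest : ∀ {a} → a ∈ A → ∀ S → A ⊆ vertices S → Connected S →
                           totalLength ℓ (steinerTree a) ≤ totalLength ℓ S
    steinerTree-shortest {a} a∈A S A⊆S (_ , reach) =
      let t , visits = tour-through {P = _∈ edges S} (filter (_∈? A) (allFin (#V G))) λ b∈As →
            reach a _ (A⊆S a∈A) (A⊆S (proj₂ (∈-filter⁻ (_∈? A) {xs = allFin (#V G)} b∈As)))
      in  totalLength-mono (steinerTree a) S
            (steinerTree≼ S t (λ {b} b∈A → visits (∈-filter⁺ (_∈? A) (∈-allFin b) b∈A))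
              -- The tour is cut as a walk from `a` to `a`, with an empty current piece at the
              -- outset.
              (cut-walk (A⊆T a∈A) (A⊆T a∈A) nil (walk t)))

    steiner-subtree : Dec (Nonempty A) → ∀ S → A ⊆ vertices S → Connected S →
                      ∃ λ S′ → Connects ℓ T A S′ × totalLength ℓ S′ ≤ totalLength ℓ S
    steiner-subtree (yes (a , a∈A)) S A⊆S connected =
      steinerTree a , steinerTree-connects a∈A , steinerTree-shortest a∈A S A⊆S connected
    -- Connected subgraphs are nonempty, so for empty `A` the competitor is a single vertex `r` of
    -- `T`, of length zero.
    steiner-subtree (no A-empty) S _ _ =
      let r , r∈T = proj₁ (proj₁ tree)
          K = component ⊥ r
      in  K ,
          ( component-⊑ {H = T} (λ e∈⊥ → ⊥-elim (∉⊥ e∈⊥)) r∈T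
          , (λ a∈A → ⊥-elim (A-empty (_ , a∈A))) , component-connected ⊥ r ) ,
          totalLength-mono K S (≤⇒≼ λ e →
            indicator≤ (e ∈? edges K) λ e∈K → ⊥-elim (∉⊥ (component-edges⊆ ⊥ r e∈K)))

theorem1 : (G : Graph) (ℓ : LengthFunction G) (T : Subgraph G) →
    IsTree T → Geodesic ℓ 2 T → FullyGeodesic ℓ T
theorem1 G ℓ T tree 2-geodesic k A A⊆T _ = ≤∞-antisym
  (sd-glb (whole G) A λ S (_ , A⊆S , connected) →
    let S′ , S′-connects , S′≤S = steiner-subtree ℓ T 2-geodesic tree A⊆T (nonempty? A) S A⊆S connected
    in  ≤∞-trans (sd-≤ T A S′ S′-connects) (fin S′≤S))
  -- A subgraph of `T` connecting `A` is also a competitor in `G`.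
  (sd-glb T A λ S (_ , A⊆S , connected) → sd-≤ (whole G) A S (⊑-whole S , A⊆S , connected))
  where open Steiner ℓ
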